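{- Let $n=2^uv$ with $v$ odd and $u\ge 0$. Suppose $(\varepsilon,\beta,\gamma;(12))\in\mathrm{Par}(n)$, where every cycle of $\beta$ has length divisible by $2^u$. Then: <ul> <li>(i) the number of cycles of odd length of $\beta$ is at least the number of cycles of odd length of $\gamma$;</li> <li>(ii) if $u\ge1$, then $\gamma$ has no cycles of odd length.</li> </ul> Fixed points count as cycles of length $1$.
   Context: A Latin square of order $n$ is an $n\times n$ array with rows, columns and symbols indexed by $[n]$, each symbol occurring once in each row and each column, with triple set $O(L)$. Permutations act on the right; $\varepsilon$ is the identity. A paratopism $(\alpha,\beta,\gamma;(12))$ maps $L$ to $L^\sigma$ with triple set $\{(y\beta,x\alpha,z\gamma):(x,y,z)\in O(L)\}$; it is an autoparatopism of $L$ if $L^\sigma=L$. $\mathrm{Par}(n)$ is the set of paratopisms that are autoparatopisms of at least one Latin square of order $n$. -}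

module Defs where

import Data.Bool.Properties as Bool
open import Data.Fin using (Fin; toℕ; fromℕ<)
open import Data.Fin.Permutation using (Permutation′; _⟨$⟩ʳ_; inverseˡ; _⟨$⟩ˡ_)
open import Data.Fin.Properties using (_≟_; any?; pigeonhole; toℕ-fromℕ<; toℕ<n)
open import Data.Fin.Subset using (Subset; ∣_∣)
open import Data.List using (List; map; allFin; deduplicate; filter; length)
open import Data.Nat using (ℕ; zero; suc; _*_; _∸_; _<_; NonZero; >-nonZero)
open import Data.Nat.DivMod using (_%_; _/_; m≡m%n+[m/n]*n; m%n<n)
open import Data.Nat.Divisibility using (_∣_; _∣?_)
open import Data.Nat.GeneralisedArithmetic using (fold; fold-+)
open import Data.Nat.Properties using (m+[n∸m]≡n; <⇒≤; <-≤-trans; ≤-<-trans; m∸n≤m; ≤-pred; m<n⇒0<n∸m; n<1+n)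
open import Data.Product using (∃; ∃!; _×_; _,_)
open import Data.Vec using (tabulate)
open import Data.Vec.Properties using (≡-dec)
open import Relation.Binary.PropositionalEquality using (_≡_; refl; sym; trans; cong)
open import Relation.Nullary using (¬_; Dec; does)
open import Relation.Nullary.Decidable using (¬?; map′)
open import Relation.Unary using (Pred; _≐_; Decidable)
open import Level using (0ℓ)

private
  variable
    n : ℕ

Odd : ℕ → Set
Odd k = ¬ (2 ∣ k)

odd? : Decidable Odd
odd? k = ¬? (2 ∣? k)

record LatinSquare (n : ℕ) : Set where
  field
    entry        : Fin n → Fin n → Fin n
    row-latin    : ∀ x z → ∃! _≡_ λ y → entry x y ≡ z
    column-latin : ∀ y z → ∃! _≡_ λ x → entry x y ≡ z

Triple : ℕ → Set
Triple n = Fin n × Fin n × Fin n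

O : LatinSquare n → Pred (Triple n) 0ℓ
O L (x , y , z) = LatinSquare.entry L x y ≡ z

-- ⟨ α , β , γ ⟩₁₂ is the paratopism (α, β, γ; (12)).
record Paratopism₁₂ (n : ℕ) : Set where
  constructor ⟨_,_,_⟩₁₂
  field
    α β γ : Permutation′ n

-- The triple set of L^σ.  The right action xα is written α ⟨$⟩ʳ x.
image : Paratopism₁₂ n → LatinSquare n → Pred (Triple n) 0ℓ
image ⟨ α , β , γ ⟩₁₂ L t =
  ∃ λ x → ∃ λ y → ∃ λ z →
    O L (x , y , z) × t ≡ (β ⟨$⟩ʳ y , α ⟨$⟩ʳ x , γ ⟨$⟩ʳ z)

IsAutoparatopism : Paratopism₁₂ n → LatinSquare n → Set
IsAutoparatopism σ L = image σ L ≐ O L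

-- The members of Par(n) whose coordinate permutation is (12).
Par₁₂ : (n : ℕ) → Pred (Paratopism₁₂ n) 0ℓ
Par₁₂ n σ = ∃ λ (L : LatinSquare n) → IsAutoparatopism σ L

_^_·_ : Permutation′ n → ℕ → Fin n → Fin n
π ^ k · i = fold i (π ⟨$⟩ʳ_) k

-- j lies on the cycle of π through i.  Nonnegative powers suffice, as
-- permutations of a finite set have finite order.
OnCycle : Permutation′ n → Fin n → Fin n → Set
OnCycle π i j = ∃ λ k → π ^ k · i ≡ j

private
  cancel : (π : Permutation′ n) (a : ℕ) {i j : Fin n} → π ^ a · i ≡ π ^ a · j → i ≡ j
  cancel π zero    eq = eq
  cancel π (suc a) eq =
    cancel π a (trans (sym (inverseˡ π)) (trans (cong (π ⟨$⟩ˡ_) eq) (inverseˡ π)))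

  period : (π : Permutation′ n) (i : Fin n) → ∃ λ d → 0 < d × d < suc n × π ^ d · i ≡ i
  period {n} π i with pigeonhole (n<1+n n) (λ (a : Fin (suc n)) → π ^ toℕ a · i)
  ... | a , b , a<b , eq =
    toℕ b ∸ toℕ a , m<n⇒0<n∸m a<b , d<1+n , sym (cancel π (toℕ a) (trans eq step))
    where
    d<1+n : toℕ b ∸ toℕ a < suc n
    d<1+n = ≤-<-trans (m∸n≤m (toℕ b) (toℕ a)) (toℕ<n b)
    step : π ^ toℕ b · i ≡ π ^ toℕ a · (π ^ (toℕ b ∸ toℕ a) · i)
    step = trans (cong (λ k → π ^ k · i) (sym (m+[n∸m]≡n (<⇒≤ a<b))))
                 (fold-+ i _ (toℕ a))

  multiple : (π : Permutation′ n) (i : Fin n) (d : ℕ) → π ^ d · i ≡ i → ∀ q → π ^ (q * d) · i ≡ i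
  multiple π i d eq zero    = refl
  multiple π i d eq (suc q) =
    trans (fold-+ i _ d) (trans (cong (λ x → π ^ d · x) (multiple π i d eq q)) eq)

  bounded : (π : Permutation′ n) (i j : Fin n) → OnCycle π i j →
            ∃ λ (k : Fin n) → π ^ toℕ k · i ≡ j
  bounded {n} π i j (k , eq) with period π i
  ... | d , 0<d , d<1+n , fix =
    fromℕ< r<n , trans (cong (λ m → π ^ m · i) (toℕ-fromℕ< r<n)) (trans (sym reduce) eq)
    where
    instance
      d≢0 : NonZero d
      d≢0 = >-nonZero 0<d
    r<n : k % d < n
    r<n = <-≤-trans (m%n<n k d) (≤-pred d<1+n)
    reduce : π ^ k · i ≡ π ^ (k % d) · i
    reduce = trans (cong (λ m → π ^ m · i) (m≡m%n+[m/n]*n k d))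
            (trans (fold-+ i _ (k % d))
                   (cong (λ x → π ^ (k % d) · x) (multiple π i d fix (k / d))))

onCycle? : (π : Permutation′ n) (i j : Fin n) → Dec (OnCycle π i j)
onCycle? π i j = map′ (λ (k , eq) → toℕ k , eq) (bounded π i j)
                      (any? λ k → π ^ toℕ k · i ≟ j)

-- A cycle is represented by its support, so its length is ∣_∣.
cycleThrough : Permutation′ n → Fin n → Subset n
cycleThrough π i = tabulate λ j → does (onCycle? π i j)

-- Each cycle of π exactly once, fixed points included.
cycles : Permutation′ n → List (Subset n)
cycles {n} π = deduplicate (≡-dec Bool._≟_) (map (cycleThrough π) (allFin n))

#oddCycles : Permutation′ n → ℕ
#oddCycles π = length (filter (λ C → odd? ∣ C ∣) (cycles π))

{-# OPTIONS --safe #-}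
-- Put σ = (ε, β, γ; (12)).  If zγᶜ = z with c = 2m + 1, then σᶜ preserves the
-- permutation matrix {(x, f x)} of the cells containing z, which says that
-- g x = (f x)βᵐ⁺¹ satisfies g² = βᶜ.  As 2ᵘ⁺¹ ∤ n, some cycle of g has length d
-- with 2ᵘ⁺¹ ∤ d; if d = 2e, then β^(ce) fixes a point of it, so 2ᵘ ∣ ce and hence
-- 2ᵘ⁺¹ ∣ d.  So d is odd, which gives a point x of odd β-period 2k + 1 with z in
-- the cell (x, xβᵏ).  No such x exists when u ≥ 1.  Moreover, the γ-cycle of the
-- symbol in such a cell depends only on the β-cycle of x, and (i) follows.
module Submission where

open import Defs
import Data.Bool.Properties as Bool
open import Data.Fin using (Fin; zero; suc; toℕ)
open import Data.Fin.Permutation using (Permutation′; id; permutation; _∘ₚ_; _⟨$⟩ʳ_; _⟨$⟩ˡ_; inverseˡ)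
open import Data.Fin.Properties using (_≟_; ¬∀⟶∃¬; pigeonhole; injective⇒≤)
open import Data.Fin.Subset using (Subset; inside; outside; ∣_∣) renaming (_∈_ to _∈ₛ_)
open import Data.List using (List; []; _∷_; map; concat; length; lookup; applyUpTo)
open import Data.List.Membership.Propositional using (_∈_)
open import Data.List.Membership.Propositional.Properties
open import Data.List.Properties using (length-++; length-map; length-applyUpTo; length-tabulate)
open import Data.List.Relation.Unary.All as All using (All; []; _∷_)
import Data.List.Relation.Unary.All.Properties as All
open import Data.List.Relation.Unary.AllPairs using (AllPairs; []; _∷_)
import Data.List.Relation.Unary.AllPairs.Properties as AllPairs
open import Data.List.Relation.Unary.Any using (here; there; index)
open import Data.List.Relation.Unary.Any.Properties using (lookup-index)
open import Data.List.Relation.Binary.Disjoint.Propositional using (Disjoint)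
open import Data.List.Relation.Unary.Unique.Propositional using (Unique)
import Data.List.Relation.Unary.Unique.Propositional.Properties as Unique
import Data.List.Relation.Unary.Unique.DecPropositional.Properties as DecUnique
open import Data.Nat using (ℕ; zero; suc; _+_; _*_; _∸_; _^_; _≤_; _≥_; _<_; s≤s; NonZero; >-nonZero)
open import Data.Nat.Divisibility
open import Data.Nat.DivMod using (_%_; _/_; m≡m%n+[m/n]*n; m%n<n)
open import Data.Nat.GeneralisedArithmetic using (fold-+)
open import Data.Nat.Induction using (<-rec)
open import Data.Nat.Primality using (euclidsLemma; prime[2])
open import Data.Nat.Properties hiding (_≟_)
open import Data.Nat.Tactic.RingSolver using (solve-∀)
open import Data.Product using (∃; _×_; _,_; proj₁; proj₂)
open import Data.Sum using (inj₁; inj₂)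
open import Data.Vec using ([]; _∷_; here; there)
open import Data.Vec.Properties using (≡-dec; lookup⇒[]=; []=⇒lookup; lookup∘tabulate; tabulate-cong)
open import Function using (_∘_)
open import Function.Bundles using (mk⇔)
open import Relation.Binary.PropositionalEquality using (_≡_; _≢_; refl; sym; trans; cong; subst; module ≡-Reasoning)
open import Relation.Nullary using (¬_; does; yes; no; contradiction)
open import Relation.Nullary.Decidable using (dec-true; dec-false; decidable-stable; does-⇔; _×-dec_)
open import Level using (0ℓ)
open import Relation.Unary using (Pred; Decidable)

private
  variable
    A B : Set
    n : ℕ

-- Arithmetic

odd⇒1+2m : ∀ k → Odd k → ∃ λ m → k ≡ suc (m * 2)
odd⇒1+2m zero          odd = contradiction (2 ∣0) odd
odd⇒1+2m (suc zero)    odd = 0 , refl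
odd⇒1+2m (suc (suc k)) odd =
  let m , eq = odd⇒1+2m k (odd ∘ ∣m∣n⇒∣m+n ∣-refl) in suc m , cong (2 +_) eq

odd-1+2m : ∀ m → Odd (suc (m * 2))
odd-1+2m m 2∣ = contradiction (∣1⇒≡1 (∣m+n∣m⇒∣n 2∣2m+1 (n∣m*n m))) λ ()
  where
  2∣2m+1 : 2 ∣ m * 2 + 1
  2∣2m+1 = subst (2 ∣_) (+-comm 1 (m * 2)) 2∣

odd-∣ : ∀ {k l} → k ∣ l → Odd l → Odd k
odd-∣ k∣l odd 2∣k = odd (∣-trans 2∣k k∣l)

-- Induction on `u`: by Euclid's lemma each factor 2 must come from `m`, since `c` is odd, and can
-- be cancelled on both sides.
2^u∣m*odd⇒2^u∣m : ∀ u {m c} → Odd c → 2 ^ u ∣ m * c → 2 ^ u ∣ m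
2^u∣m*odd⇒2^u∣m zero odd _ = 1∣ _
2^u∣m*odd⇒2^u∣m (suc u) {m} {c} odd div with euclidsLemma m c prime[2] (∣-trans (m∣m*n (2 ^ u)) div)
... | inj₂ 2∣c = contradiction 2∣c odd
... | inj₁ (divides q refl) =
  subst (2 ^ suc u ∣_) (*-comm 2 q)
    (*-monoʳ-∣ 2 (2^u∣m*odd⇒2^u∣m u {q} odd (*-cancelˡ-∣ 2 (subst (2 ^ suc u ∣_) (rearrange q c) div))))
  where
  rearrange : ∀ q c → q * 2 * c ≡ 2 * (q * c)
  rearrange = solve-∀

2^[1+u]∤2^u*odd : ∀ u {v} → Odd v → ¬ 2 ^ suc u ∣ 2 ^ u * v
2^[1+u]∤2^u*odd u {v} odd div =
  odd (*-cancelˡ-∣ (2 ^ u) {{m^n≢0 2 u}} (subst (_∣ 2 ^ u * v) (*-comm 2 (2 ^ u)) div))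

least : {P : Pred ℕ 0ℓ} → Decidable P → ∀ d → P d → ∃ λ l → P l × (∀ {m} → m < l → ¬ P m)
least {P} P? = <-rec _ step
  where
  step : ∀ d → (∀ {m} → m < d → P m → ∃ λ l → P l × (∀ {m} → m < l → ¬ P m)) →
         P d → ∃ λ l → P l × (∀ {m} → m < l → ¬ P m)
  step d rec Pd with anyUpTo? P? d
  ... | yes (m , m<d , Pm) = rec m<d Pm
  ... | no  none           = d , Pd , λ m<d Pm → none (_ , m<d , Pm)

-- Counting with lists without repetitions

lookup-injective : {xs : List A} → Unique xs → ∀ {i j} → lookup xs i ≡ lookup xs j → i ≡ j
lookup-injective (px ∷ u) {zero}  {zero}  eq = refl
lookup-injective (px ∷ u) {zero}  {suc j} eq = contradiction eq (All.lookup px (∈-lookup j))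
lookup-injective (px ∷ u) {suc i} {zero}  eq = contradiction (sym eq) (All.lookup px (∈-lookup i))
lookup-injective (px ∷ u) {suc i} {suc j} eq = cong suc (lookup-injective u eq)

-- Sending each index of `xs` to the index of a chosen partner in `ys` is injective. A relation in
-- place of a function leaves the choice of partner free, which suits cycles matched through some
-- cell.
length-≤ : {xs : List A} {ys : List B} (R : A → B → Set) → Unique xs →
           (∀ {x} → x ∈ xs → ∃ λ y → y ∈ ys × R x y) →
           (∀ {x x′ y} → R x y → R x′ y → x ≡ x′) →
           length xs ≤ length ys
length-≤ {xs = xs} {ys} R uxs total inj = injective⇒≤ {f = f} f-injective
  where
  f : Fin (length xs) → Fin (length ys)
  f i = index (proj₁ (proj₂ (total (∈-lookup i))))

  R-f : ∀ i → R (lookup xs i) (lookup ys (f i))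
  R-f i with total (∈-lookup i)
  ... | y , y∈ys , r = subst (R _) (lookup-index y∈ys) r

  f-injective : ∀ {i j} → f i ≡ f j → i ≡ j
  f-injective {i} {j} eq =
    lookup-injective uxs (inj (R-f i) (subst (λ k → R (lookup xs j) (lookup ys k)) (sym eq) (R-f j)))

unique∧set⇒length≡ : {xs ys : List A} → Unique xs → Unique ys →
                     (∀ {x} → x ∈ xs → x ∈ ys) → (∀ {x} → x ∈ ys → x ∈ xs) →
                     length xs ≡ length ys
unique∧set⇒length≡ uxs uys xs⊆ys ys⊆xs = ≤-antisym
  (length-≤ _≡_ uxs (λ p → _ , xs⊆ys p , refl) λ { refl refl → refl })
  (length-≤ _≡_ uys (λ p → _ , ys⊆xs p , refl) λ { refl refl → refl })

∣length-concat : ∀ {d} {xss : List (List A)} → All (λ xs → d ∣ length xs) xss → d ∣ length (concat xss)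
∣length-concat []                       = _ ∣0
∣length-concat {xss = xs ∷ _} (px ∷ ps) =
  subst (_ ∣_) (sym (length-++ xs)) (∣m∣n⇒∣m+n px (∣length-concat ps))

-- Serves to pass from distinct to disjoint, a step that holds only for subsets known to be cycles;
-- `P` carries that knowledge.
AllPairs-map-All : {P : A → Set} {R S : A → A → Set} →
                   (∀ {x y} → P x → P y → R x y → S x y) →
                   ∀ {xs} → All P xs → AllPairs R xs → AllPairs S xs
AllPairs-map-All f []       []       = []
AllPairs-map-All f (p ∷ ps) (r ∷ rs) =
  All.zipWith (λ (q , r) → f p q r) (ps , r) ∷ AllPairs-map-All f ps rs

-- Subsets as lists of their elements

elements : Subset n → List (Fin n)
elements []            = []
elements (inside ∷ p)  = zero ∷ map suc (elements p)
elements (outside ∷ p) = map suc (elements p)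

length-elements : (p : Subset n) → length (elements p) ≡ ∣ p ∣
length-elements []            = refl
length-elements (inside ∷ p)  = cong suc (trans (length-map suc (elements p)) (length-elements p))
length-elements (outside ∷ p) = trans (length-map suc (elements p)) (length-elements p)

∈-elements⁺ : {p : Subset n} {i : Fin n} → i ∈ₛ p → i ∈ elements p
∈-elements⁺ {p = inside  ∷ _} here      = here refl
∈-elements⁺ {p = inside  ∷ _} (there q) = there (∈-map⁺ suc (∈-elements⁺ q))
∈-elements⁺ {p = outside ∷ _} (there q) = ∈-map⁺ suc (∈-elements⁺ q)

∈-elements⁻ : {p : Subset n} {i : Fin n} → i ∈ elements p → i ∈ₛ p
∈-elements⁻ {p = inside ∷ _} (here refl) = here
∈-elements⁻ {p = inside ∷ _} (there q) with ∈-map⁻ suc q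
... | _ , r , refl = there (∈-elements⁻ r)
∈-elements⁻ {p = outside ∷ _} q with ∈-map⁻ suc q
... | _ , r , refl = there (∈-elements⁻ r)

elements-unique : (p : Subset n) → Unique (elements p)
elements-unique []            = []
elements-unique (inside ∷ p)  =
  All.map⁺ (All.universal (λ _ ()) _) ∷ Unique.map⁺ (λ { refl → refl }) (elements-unique p)
elements-unique (outside ∷ p) = Unique.map⁺ (λ { refl → refl }) (elements-unique p)

-- Cycles of a permutation

module _ {n} (π : Permutation′ n) where

  ^-+ : ∀ a b {i} → π ^ (a + b) · i ≡ π ^ a · (π ^ b · i)
  ^-+ a b = fold-+ _ _ a

  ^-comm : ∀ a b {i} → π ^ a · (π ^ b · i) ≡ π ^ b · (π ^ a · i)
  ^-comm a b {i} = trans (sym (^-+ a b)) (trans (cong (π ^_· i) (+-comm a b)) (^-+ b a))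

  ^-injective : ∀ a {i j} → π ^ a · i ≡ π ^ a · j → i ≡ j
  ^-injective zero    eq = eq
  ^-injective (suc a) eq =
    ^-injective a (trans (sym (inverseˡ π)) (trans (cong (π ⟨$⟩ˡ_) eq) (inverseˡ π)))

  ^-period-* : ∀ {d i} → π ^ d · i ≡ i → ∀ q → π ^ (q * d) · i ≡ i
  ^-period-* eq zero    = refl
  ^-period-* {d} eq (suc q) =
    trans (^-+ d (q * d)) (trans (cong (π ^ d ·_) (^-period-* eq q)) eq)

  ^-≡⇒period : ∀ {a b i} → a ≤ b → π ^ a · i ≡ π ^ b · i → π ^ (b ∸ a) · i ≡ i
  ^-≡⇒period {a} {b} {i} a≤b eq = sym (^-injective a (begin
    π ^ a · i                   ≡⟨ eq ⟩
    π ^ b · i                   ≡⟨ cong (π ^_· i) (m+[n∸m]≡n a≤b) ⟨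
    π ^ (a + (b ∸ a)) · i       ≡⟨ ^-+ a (b ∸ a) ⟩
    π ^ a · (π ^ (b ∸ a) · i)   ∎))
    where open ≡-Reasoning

  ^-% : ∀ {d i} .{{_ : NonZero d}} → π ^ d · i ≡ i → ∀ k → π ^ (k % d) · i ≡ π ^ k · i
  ^-% {d} {i} eq k = begin
    π ^ (k % d) · i                          ≡⟨ cong (π ^ (k % d) ·_) (^-period-* eq (k / d)) ⟨
    π ^ (k % d) · (π ^ (k / d * d) · i)      ≡⟨ ^-+ (k % d) (k / d * d) ⟨
    π ^ (k % d + k / d * d) · i              ≡⟨ cong (π ^_· i) (m≡m%n+[m/n]*n k d) ⟨
    π ^ k · i                                ∎
    where open ≡-Reasoning

  LeastPeriod : Fin n → Set
  LeastPeriod i = ∃ λ l → (0 < l × π ^ l · i ≡ i) × (∀ {m} → m < l → ¬ (0 < m × π ^ m · i ≡ i))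

  -- Two of the first n + 1 iterates of `i` coincide, and the difference of their exponents is a
  -- positive period from which `least` can start.
  leastPeriod : ∀ i → LeastPeriod i
  leastPeriod i with pigeonhole (n<1+n n) (λ a → π ^ toℕ a · i)
  ... | a , b , a<b , eq = least (λ m → (0 <? m) ×-dec (π ^ m · i ≟ i)) (toℕ b ∸ toℕ a)
                             (m<n⇒0<n∸m a<b , ^-≡⇒period (<⇒≤ a<b) eq)

  onCycle-sym : ∀ {i j} → OnCycle π i j → OnCycle π j i
  onCycle-sym {i} (k , refl) with leastPeriod i
  -- As `suc l` is a period of `i`, so is `k * suc l`; after the first `k` steps the remaining
  -- `k * l` lead back to `i`. No negative power is needed.
  ... | suc l , (_ , eq) , _ = k * l , (begin
    π ^ (k * l) · (π ^ k · i)   ≡⟨ ^-+ (k * l) k ⟨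
    π ^ (k * l + k) · i         ≡⟨ cong (π ^_· i) (trans (+-comm (k * l) k) (sym (*-suc k l))) ⟩
    π ^ (k * suc l) · i         ≡⟨ ^-period-* eq k ⟩
    i                           ∎)
    where open ≡-Reasoning

  onCycle-trans : ∀ {i j k} → OnCycle π i j → OnCycle π j k → OnCycle π i k
  onCycle-trans (a , refl) (b , refl) = b + a , ^-+ b a

  ∈-cycleThrough⁺ : ∀ {i j} → OnCycle π i j → j ∈ₛ cycleThrough π i
  ∈-cycleThrough⁺ {i} {j} o =
    lookup⇒[]= j _ (trans (lookup∘tabulate _ j) (dec-true (onCycle? π i j) o))

  ∈-cycleThrough⁻ : ∀ {i j} → j ∈ₛ cycleThrough π i → OnCycle π i j
  ∈-cycleThrough⁻ {i} {j} j∈ = decidable-stable (onCycle? π i j) λ ¬o →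
    contradiction (trans (sym member) (dec-false (onCycle? π i j) ¬o)) λ ()
    where
    member : does (onCycle? π i j) ≡ inside
    member = trans (sym (lookup∘tabulate (λ k → does (onCycle? π i k)) j)) ([]=⇒lookup j∈)

  cycleThrough-cong : ∀ {i j} → OnCycle π i j → cycleThrough π i ≡ cycleThrough π j
  cycleThrough-cong {i} {j} o = tabulate-cong λ k →
    does-⇔ (mk⇔ (onCycle-trans (onCycle-sym o)) (onCycle-trans o)) (onCycle? π i k) (onCycle? π j k)

  cycleThrough-≡⇒onCycle : ∀ {i j} → cycleThrough π i ≡ cycleThrough π j → OnCycle π i j
  cycleThrough-≡⇒onCycle eq = ∈-cycleThrough⁻ (subst (_ ∈ₛ_) (sym eq) (∈-cycleThrough⁺ (0 , refl)))

  -- The first `l` iterates of `i` list the cycle: reducing exponents modulo `l` reaches every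
  -- point, and a repetition would give a period shorter than `l`.
  ∣cycleThrough∣≡leastPeriod : ∀ i → ∣ cycleThrough π i ∣ ≡ proj₁ (leastPeriod i)
  ∣cycleThrough∣≡leastPeriod i = fromPeriod (leastPeriod i)
    where
    fromPeriod : ((l , _) : LeastPeriod i) → ∣ cycleThrough π i ∣ ≡ l
    fromPeriod (l , (0<l , eq) , minimal) = begin
      ∣ cycleThrough π i ∣                     ≡⟨ length-elements (cycleThrough π i) ⟨
      length (elements (cycleThrough π i))     ≡⟨ unique∧set⇒length≡ (elements-unique (cycleThrough π i)) orbit-unique ⊆ ⊇ ⟩
      length (applyUpTo (π ^_· i) l)           ≡⟨ length-applyUpTo _ l ⟩
      l                                        ∎
      where
      open ≡-Reasoning
      instance
        l≢0 : NonZero l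
        l≢0 = >-nonZero 0<l

      orbit-unique : Unique (applyUpTo (π ^_· i) l)
      orbit-unique = Unique.applyUpTo⁺₁ _ l λ {a} {b} a<b b<l e →
        minimal (≤-<-trans (m∸n≤m b a) b<l) (m<n⇒0<n∸m a<b , ^-≡⇒period (<⇒≤ a<b) e)

      ⊆ : ∀ {j} → j ∈ elements (cycleThrough π i) → j ∈ applyUpTo (π ^_· i) l
      ⊆ j∈ with ∈-cycleThrough⁻ (∈-elements⁻ j∈)
      ... | k , refl = subst (_∈ applyUpTo (π ^_· i) l) (^-% eq k) (∈-applyUpTo⁺ (π ^_· i) (m%n<n k l))

      ⊇ : ∀ {j} → j ∈ applyUpTo (π ^_· i) l → j ∈ elements (cycleThrough π i)
      ⊇ j∈ with ∈-applyUpTo⁻ (π ^_· i) j∈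
      ... | k , _ , refl = ∈-elements⁺ (∈-cycleThrough⁺ (k , refl))

  ^-∣cycleThrough∣ : ∀ i → π ^ ∣ cycleThrough π i ∣ · i ≡ i
  ^-∣cycleThrough∣ i = subst (λ l → π ^ l · i ≡ i) (sym (∣cycleThrough∣≡leastPeriod i))
    (proj₂ (proj₁ (proj₂ (leastPeriod i))))

  -- The remainder of `k` modulo the least period again fixes `i`, so minimality makes it zero.
  ∣cycleThrough∣∣period : ∀ {i k} → π ^ k · i ≡ i → ∣ cycleThrough π i ∣ ∣ k
  ∣cycleThrough∣∣period {i} {k} fix =
    subst (_∣ k) (sym (∣cycleThrough∣≡leastPeriod i)) (fromPeriod (leastPeriod i))
    where
    fromPeriod : ((l , _) : LeastPeriod i) → l ∣ k
    fromPeriod (l , (0<l , eq) , minimal) = m%n≡0⇒n∣m k l (n≤0⇒n≡0 (≮⇒≥ λ 0<r →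
      minimal (m%n<n k l) (0<r , trans (^-% eq k) fix)))
      where
      instance
        l≢0 : NonZero l
        l≢0 = >-nonZero 0<l

  -- The cycles as a partition of the points

  cycles-unique : Unique (cycles π)
  cycles-unique = DecUnique.deduplicate-! (≡-dec Bool._≟_) _

  ∈-cycles⁺ : ∀ i → cycleThrough π i ∈ cycles π
  ∈-cycles⁺ i = ∈-deduplicate⁺ (≡-dec Bool._≟_) (∈-map⁺ (cycleThrough π) (∈-allFin i))

  ∈-cycles⁻ : ∀ {C} → C ∈ cycles π → ∃ λ i → C ≡ cycleThrough π i
  ∈-cycles⁻ C∈ with ∈-map⁻ (cycleThrough π) (∈-deduplicate⁻ (≡-dec Bool._≟_) _ C∈)
  ... | i , _ , eq = i , eq

  -- Concatenating the pairwise disjoint cycles lists every point once, so `n` is the sum of the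
  -- cycle lengths.
  ∣cycles⇒∣n : ∀ {d} → (∀ i → d ∣ ∣ cycleThrough π i ∣) → d ∣ n
  ∣cycles⇒∣n {d} div = subst (d ∣_) length-concat (∣length-concat (All.map⁺ (All.tabulate d∣)))
    where
    d∣ : ∀ {C} → C ∈ cycles π → d ∣ length (elements C)
    d∣ {C} C∈ with ∈-cycles⁻ C∈
    ... | i , refl = subst (d ∣_) (sym (length-elements C)) (div i)

    disjoint : ∀ {C D} → C ∈ cycles π → D ∈ cycles π → C ≢ D → Disjoint (elements C) (elements D)
    disjoint C∈ D∈ C≢D (j∈C , j∈D) with ∈-cycles⁻ C∈ | ∈-cycles⁻ D∈
    ... | _ , refl | _ , refl = C≢D (trans
      (cycleThrough-cong (∈-cycleThrough⁻ (∈-elements⁻ j∈C)))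
      (sym (cycleThrough-cong (∈-cycleThrough⁻ (∈-elements⁻ j∈D)))))

    concat-unique : Unique (concat (map elements (cycles π)))
    concat-unique = Unique.concat⁺ (All.map⁺ (All.universal elements-unique _))
      (AllPairs.map⁺ (AllPairs-map-All disjoint (All.tabulate λ p → p) cycles-unique))

    length-concat : length (concat (map elements (cycles π))) ≡ n
    length-concat = trans
      (unique∧set⇒length≡ concat-unique (Unique.allFin⁺ n) (λ {i} _ → ∈-allFin i) λ {i} _ →
        ∈-concat⁺′ (∈-elements⁺ (∈-cycleThrough⁺ (0 , refl))) (∈-map⁺ elements (∈-cycles⁺ i)))
      (length-tabulate {n = n} (λ i → i))

  -- On an odd cycle, 2a + 1 ≡ 0 determines a modulo the length. Concretely, adding b periods 2a + 1
  -- to a, or a periods 2b + 1 to b, gives the same exponent a + b + 2ab.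
  ^-half-unique : ∀ {i} a b → π ^ suc (a * 2) · i ≡ i → π ^ suc (b * 2) · i ≡ i → π ^ a · i ≡ π ^ b · i
  ^-half-unique {i} a b fa fb = begin
    π ^ a · i                                ≡⟨ cong (π ^ a ·_) (^-period-* fa b) ⟨
    π ^ a · (π ^ (b * suc (a * 2)) · i)      ≡⟨ ^-+ a _ ⟨
    π ^ (a + b * suc (a * 2)) · i            ≡⟨ cong (π ^_· i) (symmetric a b) ⟩
    π ^ (b + a * suc (b * 2)) · i            ≡⟨ ^-+ b _ ⟩
    π ^ b · (π ^ (a * suc (b * 2)) · i)      ≡⟨ cong (π ^ b ·_) (^-period-* fb a) ⟩
    π ^ b · i                                ∎
    where
    open ≡-Reasoning
    symmetric : ∀ a b → a + b * suc (a * 2) ≡ b + a * suc (b * 2)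
    symmetric = solve-∀

  power : ℕ → Permutation′ n
  power zero    = id
  power (suc k) = power k ∘ₚ π

  power-^ : ∀ k i → power k ⟨$⟩ʳ i ≡ π ^ k · i
  power-^ zero    i = refl
  power-^ (suc k) i = cong (π ⟨$⟩ʳ_) (power-^ k i)

-- Cells of the Latin square

module _ (L : LatinSquare n) where
  open LatinSquare L

  column : Fin n → Fin n → Fin n
  column z x = proj₁ (row-latin x z)

  entry-column : ∀ z x → entry x (column z x) ≡ z
  entry-column z x = proj₁ (proj₂ (row-latin x z))

  column-unique : ∀ {z x y} → entry x y ≡ z → column z x ≡ y
  column-unique {z} {x} = proj₂ (proj₂ (row-latin x z))

  -- The cells containing `z` form a permutation matrix; `column-latin` supplies the inverse, from
  -- columns back to rows.
  columnₚ : Fin n → Permutation′ n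
  columnₚ z = permutation (column z) (λ y → proj₁ (column-latin y z))
    (λ y → column-unique (proj₁ (proj₂ (column-latin y z))))
    (λ x → proj₂ (proj₂ (column-latin (column z x) z)) (entry-column z x))

-- Powers of the autoparatopism σ

module _ (L : LatinSquare n) (β γ : Permutation′ n) (auto : IsAutoparatopism ⟨ id , β , γ ⟩₁₂ L) where
  open LatinSquare L

  entry-σ : ∀ x y → entry (β ⟨$⟩ʳ y) x ≡ γ ⟨$⟩ʳ entry x y
  entry-σ x y = proj₁ auto (x , y , _ , refl , refl)

  -- Applying σ twice undoes the swap of coordinates: (x, y) goes to (yβ, x) and then to (xβ, yβ),
  -- while the symbol moves by γ twice.
  entry-σ^2m : ∀ m x y → entry (β ^ m · x) (β ^ m · y) ≡ γ ^ (m * 2) · entry x y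
  entry-σ^2m zero    x y = refl
  entry-σ^2m (suc m) x y =
    trans (entry-σ _ _) (cong (γ ⟨$⟩ʳ_) (trans (entry-σ _ _) (cong (γ ⟨$⟩ʳ_) (entry-σ^2m m x y))))

  entry-σ^[1+2m] : ∀ m x y → entry (β ^ suc m · y) (β ^ m · x) ≡ γ ^ suc (m * 2) · entry x y
  entry-σ^[1+2m] m x y = trans (entry-σ _ _) (cong (γ ⟨$⟩ʳ_) (entry-σ^2m m x y))

  -- The cells (x , y) that lie on σ-orbits of odd length.
  OddCell : Fin n → Fin n → Set
  OddCell x y = ∃ λ k → β ^ suc (k * 2) · x ≡ x × β ^ k · x ≡ y

  -- The row of an odd cell determines its column, by `^-half-unique`. Hence moving the row by
  -- `β ^ a` moves the whole cell by the 2a-th power of σ, and its symbol by the 2a-th power of γ.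
  oddCell-symbol-onCycle : ∀ {x x′ y y′} → OddCell x y → OddCell x′ y′ → OnCycle β x x′ →
                           OnCycle γ (entry x y) (entry x′ y′)
  oddCell-symbol-onCycle {x} (k , fix , refl) (k′ , fix′ , refl) (a , refl) = a * 2 , (begin
    γ ^ (a * 2) · entry x (β ^ k · x)              ≡⟨ entry-σ^2m a x (β ^ k · x) ⟨
    entry (β ^ a · x) (β ^ a · (β ^ k · x))        ≡⟨ cong (λ y → entry (β ^ a · x) (β ^ a · y)) (^-half-unique β k k′ fix fix″) ⟩
    entry (β ^ a · x) (β ^ a · (β ^ k′ · x))       ≡⟨ cong (entry (β ^ a · x)) (^-comm β a k′) ⟩
    entry (β ^ a · x) (β ^ k′ · (β ^ a · x))       ∎)
    where
    open ≡-Reasoning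
    -- The period of the second row is carried back along `β ^ a`, so that both half-periods concern
    -- the same point `x`.
    fix″ : β ^ suc (k′ * 2) · x ≡ x
    fix″ = ^-injective β a (trans (^-comm β a (suc (k′ * 2))) fix′)

  -- A square root of an odd power of β, from a symbol of odd period

  module Root (z : Fin n) (m : ℕ) (fix : γ ^ suc (m * 2) · z ≡ z) where
    private
      c : ℕ
      c = suc (m * 2)

    -- The c-th power of σ permutes the cells containing `z`, because γ to the power `c` fixes `z`.
    -- `g` sends the row of such a cell to the row of its image.
    g : Permutation′ n
    g = columnₚ L z ∘ₚ power β (suc m)

    g-def : ∀ x → g ⟨$⟩ʳ x ≡ β ^ suc m · column L z x
    g-def x = power-^ β (suc m) (column L z x)

    -- The image of the cell of `z` in row `x` lies in row `g ⟨$⟩ʳ x` and column `β ^ m · x`. This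
    -- identifies the column of `z` in the new row, and applying `g` again adds `suc m` further
    -- steps of β.
    g-square : ∀ x → g ⟨$⟩ʳ (g ⟨$⟩ʳ x) ≡ β ^ c · x
    g-square x = begin
      g ⟨$⟩ʳ (g ⟨$⟩ʳ x)                      ≡⟨ g-def (g ⟨$⟩ʳ x) ⟩
      β ^ suc m · column L z (g ⟨$⟩ʳ x)      ≡⟨ cong (β ^ suc m ·_) (column-unique L z-cell) ⟩
      β ^ suc m · (β ^ m · x)                ≡⟨ ^-+ β (suc m) m ⟨
      β ^ (suc m + m) · x                    ≡⟨ cong (β ^_· x) (double m) ⟩
      β ^ c · x                              ∎
      where
      open ≡-Reasoning
      double : ∀ m → suc m + m ≡ suc (m * 2)
      double = solve-∀
      z-cell : entry (g ⟨$⟩ʳ x) (β ^ m · x) ≡ z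
      z-cell = begin
        entry (g ⟨$⟩ʳ x) (β ^ m · x)                     ≡⟨ cong (λ w → entry w (β ^ m · x)) (g-def x) ⟩
        entry (β ^ suc m · column L z x) (β ^ m · x)     ≡⟨ entry-σ^[1+2m] m x (column L z x) ⟩
        γ ^ c · entry x (column L z x)                   ≡⟨ cong (γ ^ c ·_) (entry-column L z x) ⟩
        γ ^ c · z                                        ≡⟨ fix ⟩
        z                                                ∎

    g-even-power : ∀ e x → g ^ (e * 2) · x ≡ β ^ (e * c) · x
    g-even-power zero    x = refl
    g-even-power (suc e) x = begin
      g ⟨$⟩ʳ (g ⟨$⟩ʳ (g ^ (e * 2) · x))   ≡⟨ g-square _ ⟩
      β ^ c · (g ^ (e * 2) · x)           ≡⟨ cong (β ^ c ·_) (g-even-power e x) ⟩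
      β ^ c · (β ^ (e * c) · x)           ≡⟨ ^-+ β c (e * c) ⟨
      β ^ (c + e * c) · x                 ∎
      where open ≡-Reasoning

    -- Write d = 2s + 1. Since 2d steps of `g` are d * c steps of β, `x` has the odd β-period d * c.
    -- Since one step of `g` at `x` equals d + 1 steps, it is also a power of β there, and this
    -- locates the column of `z`.
    odd-period⇒oddCell : ∀ s x → g ^ suc (s * 2) · x ≡ x → OddCell x (column L z x)
    -- The witness is half of d * c - 1, as (2s + 1)(2m + 1) = 2(m + s(2m + 1)) + 1.
    odd-period⇒oddCell s x gx = m + s * c , β-fix , sym (^-injective β (suc m) f≡)
      where
      open ≡-Reasoning
      d : ℕ
      d = suc (s * 2)
      odd-product : ∀ m s → suc ((m + s * suc (m * 2)) * 2) ≡ suc (s * 2) * suc (m * 2)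
      odd-product = solve-∀
      split : ∀ m s → suc s * suc (m * 2) ≡ suc m + (m + s * suc (m * 2))
      split = solve-∀
      β-fix : β ^ suc ((m + s * c) * 2) · x ≡ x
      β-fix = begin
        β ^ suc ((m + s * c) * 2) · x   ≡⟨ cong (β ^_· x) (odd-product m s) ⟩
        β ^ (d * c) · x                 ≡⟨ g-even-power d x ⟨
        g ^ (d * 2) · x                 ≡⟨ cong (g ^_· x) (*-comm d 2) ⟩
        g ^ (2 * d) · x                 ≡⟨ ^-period-* g {d} gx 2 ⟩
        x                               ∎
      f≡ : β ^ suc m · column L z x ≡ β ^ suc m · (β ^ (m + s * c) · x)
      f≡ = begin
        β ^ suc m · column L z x                 ≡⟨ g-def x ⟨
        -- Going once around by `gx` first turns the odd exponent 1 into the even exponent 2(s + 1),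
        -- where `g-even-power` applies.
        g ⟨$⟩ʳ x                                 ≡⟨ cong (g ⟨$⟩ʳ_) gx ⟨
        g ^ (suc s * 2) · x                      ≡⟨ g-even-power (suc s) x ⟩
        β ^ (suc s * c) · x                      ≡⟨ cong (β ^_· x) (split m s) ⟩
        β ^ (suc m + (m + s * c)) · x            ≡⟨ ^-+ β (suc m) _ ⟩
        β ^ suc m · (β ^ (m + s * c) · x)        ∎

  -- If `2 ^ suc u` divided every cycle length of `g`, it would divide `n`. A cycle where this fails
  -- has odd length, and any of its points is the row of the required cell.
  odd-symbol-cell : ∀ u → (∀ x → 2 ^ u ∣ ∣ cycleThrough β x ∣) → ¬ 2 ^ suc u ∣ n →
                    ∀ z → Odd ∣ cycleThrough γ z ∣ → ∃ λ x → ∃ λ y → OddCell x y × entry x y ≡ z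
  odd-symbol-cell u β-div ¬n-div z odd with odd⇒1+2m _ odd
  ... | m , c≡ = x , column L z x , cell , entry-column L z x
    where
    open Root z m (subst (λ c → γ ^ c · z ≡ z) c≡ (^-∣cycleThrough∣ γ z))

    cycle-not-divisible : ∃ λ x → ¬ 2 ^ suc u ∣ ∣ cycleThrough g x ∣
    cycle-not-divisible = ¬∀⟶∃¬ n _ (λ x → 2 ^ suc u ∣? ∣ cycleThrough g x ∣) (¬n-div ∘ ∣cycles⇒∣n g)

    x : Fin n
    x = proj₁ cycle-not-divisible

    g-fix : g ^ ∣ cycleThrough g x ∣ · x ≡ x
    g-fix = ^-∣cycleThrough∣ g x

    -- For length 2e, the exponent e * c is a β-period of `x`, so `2 ^ u` divides it and hence
    -- divides e, as c is odd. Then `2 ^ suc u` divides the length, against the choice of `x`.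
    d-odd : Odd ∣ cycleThrough g x ∣
    d-odd (divides e d≡) = proj₂ cycle-not-divisible (subst (2 ^ suc u ∣_) (trans (*-comm 2 e) (sym d≡)) (*-monoʳ-∣ 2 2^u∣e))
      where
      β-fix : β ^ (e * suc (m * 2)) · x ≡ x
      β-fix = trans (sym (g-even-power e x)) (subst (λ d → g ^ d · x ≡ x) d≡ g-fix)
      2^u∣e : 2 ^ u ∣ e
      2^u∣e = 2^u∣m*odd⇒2^u∣m u (odd-1+2m m) (∣-trans (β-div x) (∣cycleThrough∣∣period β β-fix))

    cell : OddCell x (column L z x)
    cell = let s , d≡ = odd⇒1+2m _ d-odd in odd-period⇒oddCell s x (subst (λ d → g ^ d · x ≡ x) d≡ g-fix)

  -- Comparing the odd cycles of γ and β

  module _ (cell : ∀ z → Odd ∣ cycleThrough γ z ∣ → ∃ λ x → ∃ λ y → OddCell x y × entry x y ≡ z) where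

    -- Each odd γ-cycle is matched with the β-cycle of the row of an odd cell holding one of its
    -- symbols. Two γ-cycles matched with the same β-cycle agree by `oddCell-symbol-onCycle`.
    #oddCycles-≤ : #oddCycles γ ≤ #oddCycles β
    #oddCycles-≤ = length-≤ Meets (Unique.filter⁺ _ (cycles-unique γ)) total functional
      where
      Meets : Subset n → Subset n → Set
      Meets C D = ∃ λ x → ∃ λ y → OddCell x y × C ≡ cycleThrough γ (entry x y) × D ≡ cycleThrough β x

      functional : ∀ {C C′ D} → Meets C D → Meets C′ D → C ≡ C′
      functional (_ , _ , o , refl , refl) (_ , _ , o′ , refl , eq) =
        cycleThrough-cong γ (oddCell-symbol-onCycle o o′ (cycleThrough-≡⇒onCycle β eq))

      total : ∀ {C} → C ∈ _ → ∃ λ D → D ∈ _ × Meets C D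
      total C∈ with ∈-filter⁻ (λ C → odd? ∣ C ∣) C∈
      ... | C∈γ , C-odd with ∈-cycles⁻ γ C∈γ
      ... | z , refl with cell z C-odd
      ... | x , y , o@(k , fix , _) , refl = cycleThrough β x ,
        -- The matched β-cycle is odd because its length divides the odd period `suc (k * 2)` of
        -- `x`.
        ∈-filter⁺ (λ C → odd? ∣ C ∣) (∈-cycles⁺ β x) (odd-∣ (∣cycleThrough∣∣period β fix) (odd-1+2m k)) ,
        x , y , o , refl , refl

    -- An odd γ-cycle would yield a row with an odd β-period, but that period is a multiple of an
    -- even cycle length.
    no-odd-cycles : (∀ x → 2 ∣ ∣ cycleThrough β x ∣) → ∀ {C} → C ∈ cycles γ → ¬ Odd ∣ C ∣
    no-odd-cycles even C∈ C-odd with ∈-cycles⁻ γ C∈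
    ... | z , refl with cell z C-odd
    ... | x , _ , (k , fix , _) , _ = odd-1+2m k (∣-trans (even x) (∣cycleThrough∣∣period β fix))

theorem4p6 : ∀ (n u v : ℕ) → n ≡ 2 ^ u * v → Odd v →
    (β γ : Permutation′ n) →
    Par₁₂ n ⟨ id , β , γ ⟩₁₂ →
    All (λ C → 2 ^ u ∣ ∣ C ∣) (cycles β) →
    (#oddCycles β ≥ #oddCycles γ)
    × (u ≥ 1 → All (λ C → ¬ Odd ∣ C ∣) (cycles γ))
theorem4p6 n u v n≡ v-odd β γ (L , auto) β-div =
  #oddCycles-≤ L β γ auto cell ,
  λ u≥1 → All.tabulate (no-odd-cycles L β γ auto cell λ x → ∣-trans (2∣2^u u≥1) (2^u∣cycle x))
  where
  2^u∣cycle : ∀ x → 2 ^ u ∣ ∣ cycleThrough β x ∣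
  2^u∣cycle x = All.lookup β-div (∈-cycles⁺ β x)

  cell : ∀ z → Odd ∣ cycleThrough γ z ∣ →
         ∃ λ x → ∃ λ y → OddCell L β γ auto x y × LatinSquare.entry L x y ≡ z
  cell = odd-symbol-cell L β γ auto u 2^u∣cycle (2^[1+u]∤2^u*odd u v-odd ∘ subst (2 ^ suc u ∣_) n≡)

  2∣2^u : u ≥ 1 → 2 ∣ 2 ^ u
  2∣2^u (s≤s {n = u′} _) = m∣m*n (2 ^ u′)
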